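{- The binary operation $(x,y)\mapsto x+y$ on $\mathbb{N}$ does not belong to $\langle x\bmod y,\ 2^x\rangle$.
   Context: $\mathbb{N}$ is the set of non-negative integers. An ($r$-ary, $r\ge 1$) operation on $\mathbb{N}$ is a function $\mathbb{N}^r\to\mathbb{N}$. Conventions: $\lfloor x/0\rfloor:=0$, and $x\bmod y:=\max(x-y\lfloor x/y\rfloor,0)$, so that $x\bmod 0=x$. A set $S$ of operations on $\mathbb{N}$ is closed under substitution if, whenever $f\in S$ is $r$-ary and $g_1,\dots,g_r\in S$ are $n$-ary, the operation $\vec x\mapsto f(g_1(\vec x),\dots,g_r(\vec x))$ is in $S$. For a set $\mathcal{B}$ of operations on $\mathbb{N}$, $\langle\mathcal{B}\rangle$ denotes the closure under substitution of $\mathcal{B}\cup C\cup P$, where $C$ is the set of all constant operations on $\mathbb{N}$ (of every arity) and $P$ is the set of all projections $(x_1,\dots,x_n)\mapsto x_i$. Here $x \bmod y$ denotes the binary operation $(x,y)\mapsto x\bmod y$ and $2^x$ the unary operation $x\mapsto 2^x$. -}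

module Defs where

open import Data.Fin using (Fin)
open import Data.Nat using (ℕ; zero; suc; _*_; _∸_; _^_; _/_; NonZero)
open import Data.Vec using (Vec; []; _∷_; lookup; tabulate)
open import Function using (const)
open import Relation.Binary.PropositionalEquality using (_≗_)
open import Relation.Unary using (_∪_)

Op : ℕ → Set
Op r = Vec ℕ r → ℕ

OpSet : Set₁
OpSet = ∀ {r} → Op r → Set

unary : (ℕ → ℕ) → Op 1
unary f (x ∷ []) = f x

binary : (ℕ → ℕ → ℕ) → Op 2
binary f (x ∷ y ∷ []) = f x y

data Constant : OpSet where
  constant : ∀ {n} (c : ℕ) → Constant {n} (const c)

data Projection : OpSet where
  projection : ∀ {n} (i : Fin n) → Projection (λ xs → lookup xs i)

-- The least set containing X and closed under substitution.  Operations have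
-- arity at least 1; imposing this in `base` suffices, since then `substitute`
-- never produces an operation of arity 0.  Without function extensionality,
-- `respects` is what makes this a set of functions rather than of their
-- definitions.
data Closure (X : OpSet) : OpSet where
  base       : ∀ {r} .{{_ : NonZero r}} {f : Op r} → X f → Closure X f
  substitute : ∀ {r n} {f : Op r} {g : Fin r → Op n} →
               Closure X f → (∀ i → Closure X (g i)) →
               Closure X (λ xs → f (tabulate (λ i → g i xs)))
  respects   : ∀ {r} {f g : Op r} → f ≗ g → Closure X f → Closure X g

⟨_⟩ : OpSet → OpSet
⟨ B ⟩ = Closure (B ∪ Constant ∪ Projection)

infixl 7 _div_ _mod_

_div_ : ℕ → ℕ → ℕ
x div zero    = 0
x div (suc y) = x / suc y

-- Truncated subtraction is the max(–, 0) in the definition of mod.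
_mod_ : ℕ → ℕ → ℕ
x mod y = x ∸ y * (x div y)

data ModExp : OpSet where
  modulo : ModExp (binary _mod_)
  exp₂   : ModExp (unary (2 ^_))

{-# OPTIONS --safe #-}
-- Consider a family h x y.  Call it tame if there is a number k such that, once
-- x is restricted to x ≤ N, all its values above some threshold θ (depending
-- on N but not on y) are, for each y, among k numbers.  The point is that k
-- does not depend on N.  Tameness passes through every operation of
-- ⟨ ModExp ⟩, and both (x , y) ↦ x and (x , y) ↦ y are tame.  But x + y is not:
-- for y > θ it takes the k + 1 distinct values y, …, y + k above θ on x ≤ k.
module Submission where

open import Defs
open import Data.Nat using (ℕ; zero; suc; _+_; _*_; _∸_; _^_; _/_; _⊔_; _≤_; _<_; NonZero; s≤s; s≤s⁻¹)
open import Data.Nat.DivMod using (m%n≡m∸m/n*n; m%n<n)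
open import Data.Nat.Properties
  using (*-comm; ^-monoʳ-≤; m∸n≤m; m≤m⊔n; m≤n⊔m; m≤n+m; +-cancelʳ-≡;
         ≤-refl; ≤-reflexive; ≤-trans; <⇒≤; <⇒≢; <⇒≱)
open import Data.Empty using (⊥-elim)
open import Data.Fin using (Fin; zero; suc; toℕ)
open import Data.Fin.Properties using (pigeonhole; toℕ<n)
open import Data.List using (List; []; _∷_; length; map; cartesianProductWith; lookup)
open import Data.List.Membership.Propositional using (_∈_)
open import Data.List.Membership.Propositional.Properties
  using (∈-map⁺; ∈-cartesianProductWith⁺)
open import Data.List.Properties using (length-map; length-++)
open import Data.List.Relation.Unary.Any using (here; there; index)
open import Data.List.Relation.Unary.Any.Properties using (lookup-index)
open import Data.Product using (∃-syntax; _×_; _,_)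
open import Data.Sum using (_⊎_; inj₁; inj₂; [_,_]′)
open import Data.Vec using (tabulate)
open import Data.Vec.Properties using (lookup∘tabulate)
open import Function using (id)
open import Relation.Binary.PropositionalEquality
  using (_≡_; refl; sym; trans; cong; cong₂; subst)
open import Relation.Nullary using (¬_)

length-cartesianProductWith : ∀ {A B C : Set} (f : A → B → C) xs ys →
  length (cartesianProductWith f xs ys) ≡ length xs * length ys
length-cartesianProductWith f []       ys = refl
length-cartesianProductWith f (x ∷ xs) ys =
  trans (length-++ (map (f x) ys))
        (cong₂ _+_ (length-map (f x) ys) (length-cartesianProductWith f xs ys))

Family : Set
Family = ℕ → ℕ → ℕ

_Covers_ : ℕ × List ℕ → ℕ → Set
(θ , L) Covers n = n ≤ θ ⊎ n ∈ L

-- `L` may repeat entries or list values never taken; fixing its length at exactly `k` lets counts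
-- be computed by equations.
TameWith : ℕ → Family → Set
TameWith k h = ∀ N → ∃[ θ ] ∀ y → ∃[ L ] length L ≡ k ×
               (∀ x → x ≤ N → (θ , L) Covers h x y)

Tame : Family → Set
Tame h = ∃[ k ] TameWith k h

tame-resp : ∀ {h h′} → (∀ x y → h x y ≡ h′ x y) → Tame h → Tame h′
tame-resp h≗h′ (k , tame) = k , λ N → let (θ , cover) = tame N in
  θ , λ y → let (L , len , covers) = cover y in
  L , len , λ x x≤N → subst ((θ , L) Covers_) (h≗h′ x y) (covers x x≤N)

tame-const : ∀ c → Tame (λ _ _ → c)
tame-const c = 0 , λ _ → c , λ _ → [] , refl , λ _ _ → inj₁ ≤-refl

tame-x : Tame (λ x _ → x)
tame-x = 0 , λ N → N , λ _ → [] , refl , λ _ → inj₁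

-- No threshold independent of `y` works here, but for each `y` there is a single value to list.
tame-y : Tame (λ _ y → y)
tame-y = 1 , λ _ → 0 , λ y → (y ∷ []) , refl , λ _ _ → inj₂ (here refl)

-- By monotonicity small values stay below `2 ^ θ`; the listed ones are mapped without changing
-- their number.
tame-2^ : ∀ {h} → Tame h → Tame (λ x y → 2 ^ h x y)
tame-2^ (k , tame) = k , λ N → let (θ , cover) = tame N in
  2 ^ θ , λ y → let (L , len , covers) = cover y in
  map (2 ^_) L , trans (length-map (2 ^_) L) len , λ x x≤N →
  [ (λ h≤θ → inj₁ (^-monoʳ-≤ 2 h≤θ)) , (λ h∈L → inj₂ (∈-map⁺ (2 ^_) h∈L)) ]′ (covers x x≤N)

mod-≤ : ∀ m n → m mod n ≤ m
mod-≤ m n = m∸n≤m m (n * (m div n))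

mod-< : ∀ m n .{{_ : NonZero n}} → m mod n < n
mod-< m n@(suc _) = subst (_< n) m%n≡m-mod-n (m%n<n m n)
  where
  m%n≡m-mod-n = trans (m%n≡m∸m/n*n m n) (cong (m ∸_) (*-comm (m / n) n))

-- The extra modulus 0 accounts for m mod 0 = m.
covers-mod : ∀ {θ₁ θ₂ L₁ L₂ m n} → (θ₁ , L₁) Covers m → (θ₂ , L₂) Covers n →
             (θ₁ ⊔ θ₂ , cartesianProductWith _mod_ L₁ (0 ∷ L₂)) Covers (m mod n)
covers-mod {m = m} {n} (inj₁ m≤θ₁) _ =
  inj₁ (≤-trans (mod-≤ m n) (≤-trans m≤θ₁ (m≤m⊔n _ _)))
covers-mod (inj₂ m∈L₁) (inj₂ n∈L₂) =
  inj₂ (∈-cartesianProductWith⁺ _mod_ m∈L₁ (there n∈L₂))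
covers-mod {n = zero} (inj₂ m∈L₁) (inj₁ _) =
  inj₂ (∈-cartesianProductWith⁺ _mod_ m∈L₁ (here refl))
-- However large `m` is, a small positive modulus forces a small remainder.
covers-mod {m = m} {n = n@(suc _)} (inj₂ _) (inj₁ n≤θ₂) =
  inj₁ (≤-trans (<⇒≤ (mod-< m n)) (≤-trans n≤θ₂ (m≤n⊔m _ _)))

tame-mod : ∀ {h₁ h₂} → Tame h₁ → Tame h₂ → Tame (λ x y → h₁ x y mod h₂ x y)
tame-mod (k₁ , tame₁) (k₂ , tame₂) = k₁ * suc k₂ , λ N →
  let (θ₁ , cover₁) = tame₁ N
      (θ₂ , cover₂) = tame₂ N
  in θ₁ ⊔ θ₂ , λ y →
  let (L₁ , len₁ , covers₁) = cover₁ y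
      (L₂ , len₂ , covers₂) = cover₂ y
  in cartesianProductWith _mod_ L₁ (0 ∷ L₂) ,
     trans (length-cartesianProductWith _mod_ L₁ (0 ∷ L₂)) (cong₂ (λ a b → a * suc b) len₁ len₂) ,
     λ x x≤N → covers-mod (covers₁ x x≤N) (covers₂ x x≤N)

-- Quantifying over all tame arguments makes the induction pass through substitution.
PreservesTame : ∀ {r} → Op r → Set
PreservesTame {r} f = (h : Fin r → Family) → (∀ i → Tame (h i)) →
                      Tame (λ x y → f (tabulate (λ i → h i x y)))

⟨ModExp⟩-preservesTame : ∀ {r} {f : Op r} → ⟨ ModExp ⟩ f → PreservesTame f
⟨ModExp⟩-preservesTame (base (inj₁ modulo)) h tame = tame-mod (tame zero) (tame (suc zero))
⟨ModExp⟩-preservesTame (base (inj₁ exp₂)) h tame = tame-2^ (tame zero)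
⟨ModExp⟩-preservesTame (base (inj₂ (inj₁ (constant c)))) h tame = tame-const c
⟨ModExp⟩-preservesTame (base (inj₂ (inj₂ (projection i)))) h tame =
  tame-resp (λ x y → sym (lookup∘tabulate (λ j → h j x y) i)) (tame i)
-- The inner operations turn `h` into tame families, which serve as the arguments of the outer one.
⟨ModExp⟩-preservesTame (substitute f∈ g∈) h tame =
  ⟨ModExp⟩-preservesTame f∈ _ (λ i → ⟨ModExp⟩-preservesTame (g∈ i) h tame)
⟨ModExp⟩-preservesTame (respects f≗g f∈) h tame =
  tame-resp (λ x y → f≗g _) (⟨ModExp⟩-preservesTame f∈ h tame)

+-not-tame : ¬ Tame _+_
+-not-tame (k , tame) =
  -- Bound `k` admits `suc k` values of `x`; taking `y = suc θ` puts every sum above the threshold.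
  let (θ , cover) = tame k
      (L , len , covers) = cover (suc θ)
      value∈L : (i : Fin (suc k)) → toℕ i + suc θ ∈ L
      value∈L i = [ (λ i+y≤θ → ⊥-elim (<⇒≱ (m≤n+m (suc θ) (toℕ i)) i+y≤θ)) , id ]′
                  (covers (toℕ i) (s≤s⁻¹ (toℕ<n i)))
      -- Two of the `suc k` sums share one of the `k` positions in `L`, hence are equal.
      (i , j , i<j , same-index) =
        pigeonhole (s≤s (≤-reflexive len)) (λ i → index (value∈L i))
      i+y≡j+y = trans (lookup-index (value∈L i))
                (trans (cong (lookup L) same-index) (sym (lookup-index (value∈L j))))
  in <⇒≢ i<j (+-cancelʳ-≡ (suc θ) (toℕ i) (toℕ j) i+y≡j+y)

theorem6 : ¬ ⟨ ModExp ⟩ (binary _+_)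
-- On the two coordinate families, `binary _+_` computes to `x + y`.
theorem6 +∈ = +-not-tame (⟨ModExp⟩-preservesTame +∈ h tame)
  where
  h : Fin 2 → Family
  h zero    x y = x
  h (suc _) x y = y

  tame : ∀ i → Tame (h i)
  tame zero    = tame-x
  tame (suc _) = tame-y
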